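{- Let $N>0$ be an integer. There is no integer $C$ such that for every integer $n\ge 0$ there exists an integer index $j\ge 0$ (depending on $n$ and $N$) with $$\sum_{i=0}^{4N+1} P(n+i) = C\cdot P(j).$$
   Context: The Pell numbers are defined by $P(0)=0$, $P(1)=1$ and $P(n)=2P(n-1)+P(n-2)$ for $n\ge 2$. -}

module Defs where

open import Data.Nat using (ℕ; zero; suc; _+_; _*_)

P : ℕ → ℕ
P zero = 0
P (suc zero) = 1
P (suc (suc n)) = 2 * P (suc n) + P n

-- The block sums S(n) = P(n) + ⋯ + P(n + 4N + 1) satisfy S(1) < S(2) < 5 S(1).
-- If S(1) = C P(i) and S(2) = C P(j), then P(i) < P(j) < 5 P(i),
-- so j = i + 1 because P(i + 2) ≥ 5 P(i). But P(k) ≡ k (mod 2), so every block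
-- has exactly 2N + 1 odd terms; hence S(1) and S(2) are odd, and so are P(i) and
-- P(j), i.e. i and j are both odd.

module Submission where

open import Data.Nat using (ℕ; zero; suc; _+_; _*_; _≤_; _<_; _>_; _≤′_; ≤′-refl; ≤′-step; z≤n; s≤s⁻¹; parity)
open import Data.Nat.Properties
open import Data.Nat.Tactic.RingSolver using (solve-∀)
open import Data.Integer using (ℤ; +_; ∣_∣) renaming (_*_ to _*ℤ_)
open import Data.Integer.Properties using (abs-*)
open import Data.List using (List; []; _∷_; map; upTo; applyUpTo)
open import Data.List.Properties using (map-upTo)
open import Data.Nat.ListAction using (sum)
open import Data.Parity.Base as ℙ using (1ℙ)
open import Data.Parity.Properties using (suc-homo-⁻¹; +-homo-+; *-homo-*; p≢p⁻¹)
open import Data.Product using (Σ-syntax; _,_)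
open import Function using (_∘_)
open import Relation.Nullary using (¬_)
open import Relation.Binary.PropositionalEquality using (_≡_; refl; sym; trans; cong; cong₂; subst₂; module ≡-Reasoning)
open import Defs

2*P≤P-suc : ∀ n → 2 * P n ≤ P (suc n)
2*P≤P-suc zero    = z≤n
2*P≤P-suc (suc n) = m≤m+n (2 * P (suc n)) (P n)

P≤P-suc : ∀ n → P n ≤ P (suc n)
P≤P-suc n = ≤-trans (m≤m+n (P n) _) (2*P≤P-suc n)

P-mono-≤ : ∀ {m n} → m ≤ n → P m ≤ P n
P-mono-≤ = go ∘ ≤⇒≤′
  where
  go : ∀ {m n} → m ≤′ n → P m ≤ P n
  go ≤′-refl          = ≤-refl
  go (≤′-step {n} m≤n) = ≤-trans (go m≤n) (P≤P-suc n)

P-cancel-< : ∀ {m n} → P m < P n → m < n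
P-cancel-< Pm<Pn = ≰⇒> (<⇒≱ Pm<Pn ∘ P-mono-≤)

0<P-suc : ∀ n → 0 < P (suc n)
0<P-suc n = P-mono-≤ {1} (m≤m+n 1 n)

-- The recurrence writes `P (2 + n)` as two copies of `P (suc n)`, each at least `2 * P n`, plus one
-- more `P n`.
5*P≤P-2+ : ∀ n → 5 * P n ≤ P (2 + n)
5*P≤P-2+ n = begin
  5 * P n               ≡⟨ lemma (P n) ⟩
  2 * (2 * P n) + P n   ≤⟨ +-monoˡ-≤ (P n) (*-monoʳ-≤ 2 (2*P≤P-suc n)) ⟩
  2 * P (suc n) + P n   ∎
  where
  open ≤-Reasoning
  lemma : ∀ x → 5 * x ≡ 2 * (2 * x) + x
  lemma = solve-∀

P-suc<P-2+ : ∀ n → P (suc n) < P (2 + n)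
P-suc<P-2+ n = <-≤-trans (m<m+n (P (suc n)) (≤-trans (0<P-suc n) (m≤m+n _ 0))) (2*P≤P-suc (suc n))

P-2+<5*P-suc : ∀ n → P (2 + n) < 5 * P (suc n)
P-2+<5*P-suc n = begin-strict
  2 * P (suc n) + P n               ≤⟨ +-monoʳ-≤ (2 * P (suc n)) (P≤P-suc n) ⟩
  -- The total so far is three copies of `P (suc n)`; the two copies still missing from five are
  -- positive, which makes the bound strict.
  2 * P (suc n) + P (suc n)         <⟨ m<m+n _ (≤-trans (0<P-suc n) (m≤m+n _ _)) ⟩
  2 * P (suc n) + P (suc n) + 2 * P (suc n) ≡⟨ lemma (P (suc n)) ⟩
  5 * P (suc n)                     ∎
  where
  open ≤-Reasoning
  lemma : ∀ x → 2 * x + x + 2 * x ≡ 5 * x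
  lemma = solve-∀

-- Monotonicity read backwards: `P j < 5 * P i ≤ P (2 + i)` forces `j < 2 + i`, and `P i < P j`
-- forces `i < j`.
P-indices-consecutive : ∀ {i j} → P i < P j → P j < 5 * P i → j ≡ suc i
P-indices-consecutive {i} Pi<Pj Pj<5Pi = ≤-antisym
  (s≤s⁻¹ (P-cancel-< (<-≤-trans Pj<5Pi (5*P≤P-2+ i))))
  (P-cancel-< Pi<Pj)

parity-P : ∀ n → parity (P n) ≡ parity n
parity-P zero          = refl
parity-P (suc zero)    = refl
parity-P (suc (suc n)) = begin
  parity (2 * P (suc n) + P n)                ≡⟨ +-homo-+ (2 * P (suc n)) (P n) ⟩
  -- `parity 2` computes to `0ℙ`, so the even summand vanishes and the index drops by two.
  parity (2 * P (suc n)) ℙ.+ parity (P n)     ≡⟨ cong (ℙ._+ parity (P n)) (*-homo-* 2 (P (suc n))) ⟩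
  parity (P n)                                ≡⟨ parity-P n ⟩
  parity n                                    ∎
  where open ≡-Reasoning

sum-map-mono-≤ : ∀ {f g : ℕ → ℕ} → (∀ i → f i ≤ g i) → ∀ xs → sum (map f xs) ≤ sum (map g xs)
sum-map-mono-≤ f≤g []       = z≤n
sum-map-mono-≤ f≤g (x ∷ xs) = +-mono-≤ (f≤g x) (sum-map-mono-≤ f≤g xs)

sum-map-mono-< : ∀ {f g : ℕ → ℕ} → (∀ i → f i < g i) → ∀ x xs →
  sum (map f (x ∷ xs)) < sum (map g (x ∷ xs))
sum-map-mono-< f<g x xs = +-mono-<-≤ (f<g x) (sum-map-mono-≤ (<⇒≤ ∘ f<g) xs)

sum-map-* : ∀ c (f : ℕ → ℕ) xs → sum (map (λ i → c * f i) xs) ≡ c * sum (map f xs)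
sum-map-* c f []       = sym (*-zeroʳ c)
sum-map-* c f (x ∷ xs) =
  trans (cong (λ s → c * f x + s) (sum-map-* c f xs)) (sym (*-distribˡ-+ c (f x) _))

-- Adjacent entries are paired off, and each pair contributes `1ℙ`. The length is `k * 2` rather
-- than `2 * k` so that `suc k * 2` reduces and exposes two entries at once.
parity-sum-pairs : ∀ (f : ℕ → ℕ) → (∀ i → parity (f i + f (suc i)) ≡ 1ℙ) →
  ∀ k → parity (sum (applyUpTo f (k * 2))) ≡ parity k
parity-sum-pairs f odd zero    = refl
parity-sum-pairs f odd (suc k) = begin
  parity (f 0 + (f 1 + s))                ≡⟨ cong parity (+-assoc (f 0) (f 1) s) ⟨
  parity (f 0 + f 1 + s)                  ≡⟨ +-homo-+ (f 0 + f 1) s ⟩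
  parity (f 0 + f 1) ℙ.+ parity s         ≡⟨ cong₂ ℙ._+_ (odd 0) (parity-sum-pairs (f ∘ suc ∘ suc) (odd ∘ suc ∘ suc) k) ⟩
  1ℙ ℙ.+ parity k                         ≡⟨ +-homo-+ 1 k ⟨
  parity (suc k)                          ∎
  where
  open ≡-Reasoning
  s = sum (applyUpTo (f ∘ suc ∘ suc) (k * 2))

-- By `parity-P` the question passes to the indices, whose sum is `1 + 2 * n`.
parity-P-+-P-suc : ∀ n → parity (P n + P (suc n)) ≡ 1ℙ
parity-P-+-P-suc n = begin
  parity (P n + P (suc n))             ≡⟨ +-homo-+ (P n) (P (suc n)) ⟩
  parity (P n) ℙ.+ parity (P (suc n))  ≡⟨ cong₂ ℙ._+_ (parity-P n) (parity-P (suc n)) ⟩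
  parity n ℙ.+ parity (suc n)          ≡⟨ +-homo-+ n (suc n) ⟨
  parity (n + suc n)                   ≡⟨ cong parity (lemma n) ⟩
  parity (1 + 2 * n)                   ≡⟨ +-homo-+ 1 (2 * n) ⟩
  1ℙ ℙ.+ parity (2 * n)                ≡⟨ cong (1ℙ ℙ.+_) (*-homo-* 2 n) ⟩
  1ℙ                                   ∎
  where
  open ≡-Reasoning
  lemma : ∀ n → n + suc n ≡ 1 + 2 * n
  lemma = solve-∀

blockSum : ℕ → ℕ → ℕ
blockSum N n = sum (map (λ i → P (n + i)) (upTo (suc (4 * N + 1))))

-- The `4 * N + 2` terms split into `1 + 2 * N` adjacent pairs: an odd number of pairs, each with
-- odd sum.
parity-blockSum : ∀ N n → parity (blockSum N n) ≡ 1ℙ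
parity-blockSum N n = begin
  parity (blockSum N n)                               ≡⟨ cong (parity ∘ sum) (map-upTo f (suc (4 * N + 1))) ⟩
  parity (sum (applyUpTo f (suc (4 * N + 1))))        ≡⟨ cong (parity ∘ sum ∘ applyUpTo f) (lemma N) ⟩
  parity (sum (applyUpTo f ((1 + 2 * N) * 2)))        ≡⟨ parity-sum-pairs f odd (1 + 2 * N) ⟩
  parity (1 + 2 * N)                                  ≡⟨ +-homo-+ 1 (2 * N) ⟩
  1ℙ ℙ.+ parity (2 * N)                               ≡⟨ cong (1ℙ ℙ.+_) (*-homo-* 2 N) ⟩
  1ℙ                                                  ∎
  where
  open ≡-Reasoning
  f : ℕ → ℕ
  f i = P (n + i)
  odd : ∀ i → parity (f i + f (suc i)) ≡ 1ℙ
  odd i = trans (cong (λ m → parity (f i + P m)) (+-suc n i)) (parity-P-+-P-suc (n + i))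
  lemma : ∀ N → suc (4 * N + 1) ≡ (1 + 2 * N) * 2
  lemma = solve-∀

-- The blocks are compared term by term. `upTo (suc m)` reduces to `0 ∷ applyUpTo suc m`, the
-- nonempty list that strictness requires.
blockSum-1<2 : ∀ N → blockSum N 1 < blockSum N 2
blockSum-1<2 N = sum-map-mono-< P-suc<P-2+ 0 (applyUpTo suc (4 * N + 1))

-- The starting points 1 and 2 matter for this termwise bound: one index earlier it would require
-- `P 1 < 5 * P 0`, which is false.
blockSum-2<5*1 : ∀ N → blockSum N 2 < 5 * blockSum N 1
blockSum-2<5*1 N = <-≤-trans (sum-map-mono-< P-2+<5*P-suc 0 (applyUpTo suc (4 * N + 1)))
  (≤-reflexive (sum-map-* 5 (P ∘ suc) (upTo (suc (4 * N + 1)))))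

*-odd⇒oddʳ : ∀ m n → parity (m * n) ≡ 1ℙ → parity n ≡ 1ℙ
*-odd⇒oddʳ m n odd = go (parity m) (parity n) (trans (sym (*-homo-* m n)) odd)
  where
  go : ∀ p q → p ℙ.* q ≡ 1ℙ → q ≡ 1ℙ
  -- A factor `0ℙ` would make the product `0ℙ`, contradicting the equation, so only `p = 1ℙ`
  -- remains.
  go 1ℙ q eq = eq

theorem4p1 : (N : ℕ) → N > 0 →
    ¬ (Σ[ C ∈ ℤ ] ((n : ℕ) → Σ[ j ∈ ℕ ]
    + (sum (map (λ i → P (n + i)) (upTo (suc (4 * N + 1))))) ≡ C *ℤ (+ P j)))
theorem4p1 N _ (C , representation) with representation 1 | representation 2
... | i , eq₁ | j , eq₂ = p≢p⁻¹ 1ℙ (begin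
  1ℙ                       ≡⟨ odd-index i 1 S₁≡ ⟨
  parity i                 ≡⟨ suc-homo-⁻¹ i ⟨
  parity (suc i) ℙ.⁻¹      ≡⟨ cong (λ k → parity k ℙ.⁻¹) j≡1+i ⟨
  parity j ℙ.⁻¹            ≡⟨ cong ℙ._⁻¹ (odd-index j 2 S₂≡) ⟩
  1ℙ ℙ.⁻¹                  ∎)
  where
  open ≡-Reasoning
  -- Block sums and Pell numbers are natural, so taking absolute values moves both equations to ℕ
  -- whatever the sign of `C`.
  c = ∣ C ∣

  S₁≡ : blockSum N 1 ≡ c * P i
  S₁≡ = trans (cong ∣_∣ eq₁) (abs-* C (+ P i))

  S₂≡ : blockSum N 2 ≡ c * P j
  S₂≡ = trans (cong ∣_∣ eq₂) (abs-* C (+ P j))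

  odd-index : ∀ k n → blockSum N n ≡ c * P k → parity k ≡ 1ℙ
  odd-index k n eq = trans (sym (parity-P k))
    (*-odd⇒oddʳ c (P k) (trans (cong parity (sym eq)) (parity-blockSum N n)))

  5*-swap : ∀ x y → 5 * (x * y) ≡ x * (5 * y)
  5*-swap = solve-∀

  j≡1+i : j ≡ suc i
  j≡1+i = P-indices-consecutive
    -- A strict inequality between two multiples of `c` already excludes `c = 0`, so `c` can be
    -- cancelled here and in the next bound.
    (*-cancelˡ-< c (P i) (P j) (subst₂ _<_ S₁≡ S₂≡ (blockSum-1<2 N)))
    (*-cancelˡ-< c (P j) (5 * P i)
      (subst₂ _<_ S₂≡ (trans (cong (5 *_) S₁≡) (5*-swap c (P i))) (blockSum-2<5*1 N)))
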